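{- For every finite simple undirected graph $G=(V,E)$ and threshold assignment $\tau$, the greedy algorithm described in the context finds a timed target set in the non-progressive model: if $\mathcal{S}_0,\mathcal{S}_1$ are the sets it has built when it terminates, then the sequence $\mathcal{S}_0,\mathcal{S}_1,\emptyset$ is a TTS of $(G,\tau)$.
   Context: $N(v)$ is the set of neighbors of $v$ and $d(v)=|N(v)|$. A threshold assignment is a function $\tau:V\to\mathbb{N}\cup\{0\}$ with $0\le\tau(v)\le d(v)$ for all $v$. A finite sequence $\mathcal{S}_0,\ldots,\mathcal{S}_k$ of subsets of $V$ is a timed target set (TTS) of $(G,\tau)$ if there is a sequence $Q_0,\ldots,Q_k$ of subsets of $V$ such that (i) $Q_0=\emptyset$; (ii) for $i\ge1$, $v\in Q_i$ if and only if $|N(v)\cap(\mathcal{S}_{i-1}\cup Q_{i-1})|\ge\tau(v)$; (iii) $\mathcal{S}_k=\emptyset$; (iv) $Q_k=V$. Greedy algorithm. Input $(G,\tau)$. Sort the nodes in ascending order of degree as $v_1,\ldots,v_n$. Initialize $\mathcal{S}_0=\emptyset$, $\mathcal{S}_1=\emptyset$, and for every $1\le i\le n$: $\mathrm{unselected}[v_i]=0$, $\mathrm{blocked}[v_i]=\emptyset$. The algorithm keeps a working copy of $\tau$, initially the input threshold assignment, which may be modified as indicated. For $i=1,\ldots,n$ do: (1) for every $u\in N(v_i)$ with $\mathrm{unselected}[u]=d(u)-\tau(u)$ (current working value of $\tau(u)$), add $u$ to $\mathrm{blocked}[v_i]$; (2) if $|\mathrm{blocked}[v_i]|=0$: increase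 $\mathrm{unselected}[u]$ by 1 for every $u\in N(v_i)$; (3) if $|\mathrm{blocked}[v_i]|>1$: add $v_i$ to $\mathcal{S}_0$; (4) if $|\mathrm{blocked}[v_i]|=1$, let $w$ be its only element: if $d(w)>d(v_i)$, increase $\mathrm{unselected}[u]$ by 1 for every $u\in N(v_i)$, add $w$ to $\mathcal{S}_1$, and set the working value $\tau(w)=0$; otherwise add $v_i$ to $\mathcal{S}_0$. -}

module Defs where

open import Data.Bool using (if_then_else_)
open import Data.Fin using (Fin; zero; suc; inject₁; fromℕ)
open import Data.Fin.Subset using (Subset; _∈_; _∩_; _∪_; ⁅_⁆; ∣_∣; ⊥; ⊤)
open import Data.Fin.Subset.Properties using (_∈?_)
open import Data.List using (List; []; _∷_; allFin; filter; foldl)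
open import Data.List.Relation.Binary.Permutation.Propositional using (_↭_)
import Data.List.Relation.Unary.Sorted.TotalOrder as SortedBy
import Data.List.Sort as Sort
open import Data.Nat using (ℕ; zero; suc; _∸_; _≤_; _≥_; _≟_; _<?_)
open import Data.Nat.Properties using (≤-decTotalOrder)
open import Data.Product using (∃; _×_; _,_)
open import Data.Vec using (Vec; lookup; tabulate)
open import Data.Vec.Functional using (Vector; updateAt)
open import Function using (const; _∘_; _⇔_)
open import Level using (0ℓ)
open import Relation.Binary using (Rel; Decidable; Symmetric; Irreflexive; DecTotalOrder)
import Relation.Binary.Construct.On as On
open import Relation.Binary.PropositionalEquality using (_≡_)
open import Relation.Nullary using (does)
open import Relation.Nullary.Decidable using (_×-dec_)
import Relation.Unary as U

record SimpleGraph (n : ℕ) : Set₁ where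
  field
    Adj    : Rel (Fin n) 0ℓ
    adj?   : Decidable Adj
    sym    : Symmetric Adj
    irrefl : Irreflexive _≡_ Adj

⟪_⟫ : ∀ {n} {P : U.Pred (Fin n) 0ℓ} → U.Decidable P → Subset n
⟪ P? ⟫ = tabulate (does ∘ P?)

elements : ∀ {n} → Subset n → List (Fin n)
elements {n} p = filter (_∈? p) (allFin n)

record State (n : ℕ) : Set where
  field
    S₀ S₁      : Subset n
    unselected : Vector ℕ n
    blocked    : Vector (Subset n) n
    thr        : Vector ℕ n  -- the working copy of τ

open State

initial : ∀ {n} → (Fin n → ℕ) → State n
initial τ = record
  { S₀ = ⊥ ; S₁ = ⊥ ; unselected = const 0 ; blocked = const ⊥ ; thr = τ }

module _ {n : ℕ} (G : SimpleGraph n) where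
  open SimpleGraph G

  N : Fin n → Subset n
  N v = ⟪ adj? v ⟫

  d : Fin n → ℕ
  d v = ∣ N v ∣

  ThresholdAssignment : (Fin n → ℕ) → Set
  ThresholdAssignment τ = ∀ v → τ v ≤ d v

  record IsTTS (τ : Fin n → ℕ) {k : ℕ} (S : Vec (Subset n) (suc k)) : Set where
    field
      Q       : Vec (Subset n) (suc k)
      Q-start : lookup Q zero ≡ ⊥
      Q-step  : ∀ (i : Fin k) v →
                v ∈ lookup Q (suc i) ⇔
                ∣ N v ∩ (lookup S (inject₁ i) ∪ lookup Q (inject₁ i)) ∣ ≥ τ v
      S-end   : lookup S (fromℕ k) ≡ ⊥
      Q-end   : lookup Q (fromℕ k) ≡ ⊤

  byDegree : DecTotalOrder 0ℓ 0ℓ 0ℓ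
  byDegree = On.decTotalOrder ≤-decTotalOrder d

  -- Nodes of equal degree may be listed in any relative order.
  IsDegreeOrdering : List (Fin n) → Set
  IsDegreeOrdering vs = vs ↭ allFin n × SortedBy.Sorted (DecTotalOrder.totalOrder byDegree) vs

  degreeOrdering-exists : ∃ IsDegreeOrdering
  degreeOrdering-exists = sort (allFin n) , sort-↭ (allFin n) , sort-↗ (allFin n)
    where open Sort byDegree

  -- Truncated subtraction is harmless: thr u ≤ d u holds throughout a run
  -- that starts from a threshold assignment.
  block : Fin n → State n → State n
  block v s = record s { blocked = updateAt (blocked s) v (_∪ saturated) }
    where
    saturated : Subset n
    saturated = ⟪ (λ u → (u ∈? N v) ×-dec (unselected s u ≟ d u ∸ thr s u)) ⟫

  incrementNeighbours : Fin n → State n → State n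
  incrementNeighbours v s = record s
    { unselected = λ u → if does (u ∈? N v) then suc (unselected s u) else unselected s u }

  select₀ : Fin n → State n → State n
  select₀ v s = record s { S₀ = S₀ s ∪ ⁅ v ⁆ }

  select₁ : Fin n → State n → State n
  select₁ w s = record s { S₁ = S₁ s ∪ ⁅ w ⁆ ; thr = updateAt (thr s) w (const 0) }

  decide : Fin n → List (Fin n) → State n → State n
  decide v []          s = incrementNeighbours v s
  decide v (w ∷ [])    s =
    if does (d v <? d w) then select₁ w (incrementNeighbours v s) else select₀ v s
  decide v (_ ∷ _ ∷ _) s = select₀ v s

  process : State n → Fin n → State n
  process s v = decide v (elements (blocked s′ v)) s′
    where s′ = block v s

  greedy : (Fin n → ℕ) → List (Fin n) → State n
  greedy τ vs = foldl process (initial τ) vs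

{-# OPTIONS --safe #-}
-- Call a node skipped if it is processed without entering S₀.  Then unselected u bounds the number
-- of skipped neighbours of u, and as long as u is not put into S₁ it stays at most d u ∸ τ u: a
-- skip is only allowed if no neighbour is saturated, or if the single saturated one enters S₁.
-- Since every node is processed, each u ∉ S₁ ends up with at least τ u neighbours in S₀, so
-- u ∈ Q₁.  Thus S₁ ∪ Q₁ = V, and Q₂ = V because τ ≤ d.
module Submission where

open import Defs
open import Data.Bool using (true; false)
open import Data.Nat using (ℕ; suc; _+_; _∸_; _≤_; z≤n; s≤s; _≟_; _≤?_; _<?_)
open import Data.Nat.Properties
open import Data.Fin as Fin using (Fin; zero; suc)
open import Data.Fin.Subset using (Subset; _∈_; _∉_; _⊆_; _∩_; _∪_; ⁅_⁆; ∣_∣; ⊥; ⊤; inside; outside)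
open import Data.Fin.Subset.Properties
open import Data.List using (List; []; _∷_; foldl; _ʳ++_)
open import Data.List.Membership.Propositional using () renaming (_∈_ to _∈ˡ_)
open import Data.List.Membership.Propositional.Properties using (∈-filter⁺; ∈-allFin)
open import Data.List.Relation.Binary.Permutation.Propositional using (↭-sym)
open import Data.List.Relation.Binary.Permutation.Propositional.Properties using (∈-resp-↭)
open import Data.List.Relation.Unary.Any using (here; there)
open import Data.List.Relation.Unary.Any.Properties using (reverse⁺)
open import Data.Product using (_×_; _,_)
open import Data.Sum using (_⊎_; inj₁; inj₂; [_,_]′; map₂)
open import Data.Vec using ([]; _∷_)
open import Data.Vec.Functional.Properties using (updateAt-updates; updateAt-minimal)
open import Data.Vec.Properties using (lookup∘tabulate; lookup⇒[]=; []=⇒lookup)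
open import Function using (_∘_; mk⇔)
open import Level using (0ℓ)
open import Relation.Binary.PropositionalEquality using (_≡_; _≢_; refl; sym; trans; cong; subst)
open import Relation.Nullary using (¬_; does; yes; no; contradiction)
open import Relation.Nullary.Decidable using (dec-true; _×-dec_)
import Relation.Unary as U

module _ {n} {P : U.Pred (Fin n) 0ℓ} (P? : U.Decidable P) where

  ∈⟪⟫⁺ : ∀ {x} → P x → x ∈ ⟪ P? ⟫
  ∈⟪⟫⁺ {x} px = lookup⇒[]= x _ (trans (lookup∘tabulate _ x) (dec-true (P? x) px))

  ∈⟪⟫⁻ : ∀ {x} → x ∈ ⟪ P? ⟫ → P x
  ∈⟪⟫⁻ {x} x∈ with P? x | trans (sym (lookup∘tabulate _ x)) ([]=⇒lookup x∈)
  ... | yes px | _ = px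
  ... | no _   | ()

∈-elements⁺ : ∀ {n} {p : Subset n} {x} → x ∈ p → x ∈ˡ elements p
∈-elements⁺ {p = p} {x} = ∈-filter⁺ (_∈? p) (∈-allFin x)

∣p∪q∣≤∣p∣+∣q∣ : ∀ {n} (p q : Subset n) → ∣ p ∪ q ∣ ≤ ∣ p ∣ + ∣ q ∣
∣p∪q∣≤∣p∣+∣q∣ []            []            = z≤n
∣p∪q∣≤∣p∣+∣q∣ (outside ∷ p) (outside ∷ q) = ∣p∪q∣≤∣p∣+∣q∣ p q
∣p∪q∣≤∣p∣+∣q∣ (outside ∷ p) (inside  ∷ q) =
  ≤-trans (s≤s (∣p∪q∣≤∣p∣+∣q∣ p q)) (≤-reflexive (sym (+-suc ∣ p ∣ ∣ q ∣)))
∣p∪q∣≤∣p∣+∣q∣ (inside  ∷ p) (outside ∷ q) = s≤s (∣p∪q∣≤∣p∣+∣q∣ p q)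
∣p∪q∣≤∣p∣+∣q∣ (inside  ∷ p) (inside  ∷ q) =
  s≤s (≤-trans (∣p∪q∣≤∣p∣+∣q∣ p q) (+-monoʳ-≤ ∣ p ∣ (n≤1+n ∣ q ∣)))

∣p∩[q∪r]∣≤∣p∩q∣+∣p∩r∣ : ∀ {n} (p q r : Subset n) → ∣ p ∩ (q ∪ r) ∣ ≤ ∣ p ∩ q ∣ + ∣ p ∩ r ∣
∣p∩[q∪r]∣≤∣p∩q∣+∣p∩r∣ p q r rewrite ∩-distribˡ-∪ p q r = ∣p∪q∣≤∣p∣+∣q∣ (p ∩ q) (p ∩ r)

∣p∩[q∪⁅x⁆]∣≤1+∣p∩q∣ : ∀ {n} (p q : Subset n) x → ∣ p ∩ (q ∪ ⁅ x ⁆) ∣ ≤ suc ∣ p ∩ q ∣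
∣p∩[q∪⁅x⁆]∣≤1+∣p∩q∣ p q x = begin
  ∣ p ∩ (q ∪ ⁅ x ⁆) ∣        ≤⟨ ∣p∩[q∪r]∣≤∣p∩q∣+∣p∩r∣ p q ⁅ x ⁆ ⟩
  ∣ p ∩ q ∣ + ∣ p ∩ ⁅ x ⁆ ∣  ≤⟨ +-monoʳ-≤ ∣ p ∩ q ∣ (∣p∩q∣≤∣q∣ p ⁅ x ⁆) ⟩
  ∣ p ∩ q ∣ + ∣ ⁅ x ⁆ ∣      ≡⟨ cong (∣ p ∩ q ∣ +_) (∣⁅x⁆∣≡1 x) ⟩
  ∣ p ∩ q ∣ + 1              ≡⟨ +-comm ∣ p ∩ q ∣ 1 ⟩
  suc ∣ p ∩ q ∣              ∎
  where open ≤-Reasoning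

x∉p⇒p∩[q∪⁅x⁆]⊆p∩q : ∀ {n} (p q : Subset n) {x} → x ∉ p → p ∩ (q ∪ ⁅ x ⁆) ⊆ p ∩ q
x∉p⇒p∩[q∪⁅x⁆]⊆p∩q p q {x} x∉p y∈ with x∈p∩q⁻ p _ y∈
... | y∈p , y∈q∪x with x∈p∪q⁻ q ⁅ x ⁆ y∈q∪x
...   | inj₁ y∈q = x∈p∩q⁺ (y∈p , y∈q)
...   | inj₂ y∈x = contradiction (subst (_∈ p) (x∈⁅y⁆⇒x≡y x y∈x) y∈p) x∉p

∣p∣≤∣p∩q∣ : ∀ {n} (p : Subset n) {q} → (∀ x → x ∈ q) → ∣ p ∣ ≤ ∣ p ∩ q ∣
∣p∣≤∣p∩q∣ p all = p⊆q⇒∣p∣≤∣q∣ {p = p} (λ {x} x∈p → x∈p∩q⁺ (x∈p , all x))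

module _ {n : ℕ} (G : SimpleGraph n) (τ : Fin n → ℕ) where
  open SimpleGraph G using (adj?) renaming (sym to Adj-sym)
  open State

  N-sym : ∀ {u v} → u ∈ N G v → v ∈ N G u
  N-sym {u} {v} = ∈⟪⟫⁺ (adj? u) ∘ Adj-sym ∘ ∈⟪⟫⁻ (adj? v)

  Saturated : State n → Fin n → Set
  Saturated s u = unselected s u ≡ d G u ∸ thr s u

  saturated⇒blocked : ∀ s {u v} → u ∈ N G v → Saturated s u → u ∈ blocked (block G v s) v
  saturated⇒blocked s {u} {v} u∈Nv sat =
    subst (u ∈_) (sym (updateAt-updates v (blocked s)))
      (x∈p∪q⁺ (inj₂ (∈⟪⟫⁺ (λ u → (u ∈? N G v) ×-dec (unselected s u ≟ d G u ∸ thr s u))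
        (u∈Nv , sat))))

  -- Saturation is tested against the working threshold, the final count against the input `τ`. The
  -- equation `thr s u ≡ τ u` lets one be read as the other; only `select₁` can break it.
  WithinBudget : State n → Fin n → Set
  WithinBudget s u = thr s u ≡ τ u × unselected s u ≤ d G u ∸ τ u

  -- The algorithm does not record `skipped`, so it is carried here as a witness. `counted` is an
  -- inequality because a node listed twice could raise counters twice but enter the set once. In
  -- `budgeted`, membership in `S₁` is permanent and releases `u` from any bound.
  record Invariant (processed : List (Fin n)) (s : State n) : Set where
    field
      skipped  : Subset n
      covered  : ∀ {v} → v ∈ˡ processed → v ∈ S₀ s ∪ skipped
      counted  : ∀ u → ∣ N G u ∩ skipped ∣ ≤ unselected s u
      budgeted : ∀ u → u ∈ S₁ s ⊎ WithinBudget s u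

  initial-invariant : Invariant [] (initial τ)
  initial-invariant = record
    { skipped  = ⊥
    ; covered  = λ ()
    ; counted  = λ u → ≤-trans (∣p∩q∣≤∣q∣ (N G u) ⊥) (≤-reflexive (∣⊥∣≡0 n))
    ; budgeted = λ _ → inj₂ (refl , z≤n)
    }

  -- By symmetry of adjacency, the counters raised are exactly those of the nodes `u` having `v` in
  -- `N G u`, the only ones whose count can grow when `v` joins `p`.
  increment-counted : ∀ v s p u → ∣ N G u ∩ p ∣ ≤ unselected s u →
                      ∣ N G u ∩ (p ∪ ⁅ v ⁆) ∣ ≤ unselected (incrementNeighbours G v s) u
  increment-counted v s p u le with u ∈? N G v
  ... | yes _    = ≤-trans (∣p∩[q∪⁅x⁆]∣≤1+∣p∩q∣ (N G u) p v) (s≤s le)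
  ... | no  u∉Nv =
    ≤-trans (p⊆q⇒∣p∣≤∣q∣ (x∉p⇒p∩[q∪⁅x⁆]⊆p∩q (N G u) p (u∉Nv ∘ N-sym))) le

  increment-withinBudget : ∀ v s u → (u ∈ N G v → ¬ Saturated s u) →
                           WithinBudget s u → WithinBudget (incrementNeighbours G v s) u
  increment-withinBudget v s u unsat (thr≡τ , le) with u ∈? N G v
  -- Not being saturated makes the bound strict, which leaves room for the increment.
  ... | yes u∈Nv = thr≡τ , ≤∧≢⇒< le (λ eq → unsat u∈Nv (trans eq (cong (d G u ∸_) (sym thr≡τ))))
  ... | no  _    = thr≡τ , le

  -- The premise exempts `w`: if saturated, it has just been pushed past its budget by the
  -- increment, and its entry into `S₁` makes up for that.
  select₁-budgeted : ∀ w s u → (u ≢ w → u ∈ S₁ s ⊎ WithinBudget s u) →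
                     u ∈ S₁ (select₁ G w s) ⊎ WithinBudget (select₁ G w s) u
  select₁-budgeted w s u budgeted with u Fin.≟ w
  ... | yes refl = inj₁ (q⊆p∪q (S₁ s) ⁅ w ⁆ (x∈⁅x⁆ w))
  ... | no  u≢w with budgeted u≢w
  ...   | inj₁ u∈S₁         = inj₁ (p⊆p∪q ⁅ w ⁆ u∈S₁)
  ...   | inj₂ (thr≡τ , le) = inj₂ (trans (updateAt-minimal u w (thr s) u≢w) thr≡τ , le)

  select₀-invariant : ∀ {vs s} v → Invariant vs s → Invariant (v ∷ vs) (select₀ G v s)
  select₀-invariant {s = s} v I = record
    { skipped  = skipped
    ; covered  = λ where
        (here refl) → p⊆p∪q skipped (q⊆p∪q (S₀ s) ⁅ v ⁆ (x∈⁅x⁆ v))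
        (there u∈)  → [ p⊆p∪q skipped ∘ p⊆p∪q ⁅ v ⁆ , q⊆p∪q (S₀ s ∪ ⁅ v ⁆) skipped ]′
                        (x∈p∪q⁻ (S₀ s) skipped (covered u∈))
    ; counted  = counted
    ; budgeted = budgeted
    } where open Invariant I

  skip-covered : ∀ {vs s} v (I : Invariant vs s) {u} → u ∈ˡ v ∷ vs →
                 u ∈ S₀ s ∪ (Invariant.skipped I ∪ ⁅ v ⁆)
  skip-covered {s = s} v I (here refl) =
    q⊆p∪q (S₀ s) _ (q⊆p∪q (Invariant.skipped I) ⁅ v ⁆ (x∈⁅x⁆ v))
  skip-covered {s = s} v I {u} (there u∈) =
    subst (u ∈_) (∪-assoc (S₀ s) skipped ⁅ v ⁆) (p⊆p∪q ⁅ v ⁆ (covered u∈))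
    where open Invariant I

  -- Abstracting the blocking list to `ws` allows matching along with `decide`. Since `ws` contains
  -- every saturated neighbour of `v`, an empty list means that there is none, and a singleton that
  -- only `w` can be one.
  decide-invariant : ∀ {vs s} v ws → (∀ {u} → u ∈ N G v → Saturated s u → u ∈ˡ ws) →
                     Invariant vs s → Invariant (v ∷ vs) (decide G v ws s)
  decide-invariant {s = s} v [] blocks I = record
    { skipped  = skipped ∪ ⁅ v ⁆
    ; covered  = skip-covered v I
    ; counted  = λ u → increment-counted v s skipped u (counted u)
    ; budgeted = λ u → map₂ (increment-withinBudget v s u (λ u∈Nv sat →
                         contradiction (blocks u∈Nv sat) λ ())) (budgeted u)
    } where open Invariant I
  decide-invariant {s = s} v (w ∷ []) blocks I with does (d G v <? d G w)
  ... | false = select₀-invariant v I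
  ... | true  = record
    { skipped  = skipped ∪ ⁅ v ⁆
    ; covered  = skip-covered v I
    ; counted  = λ u → increment-counted v s skipped u (counted u)
    ; budgeted = λ u → select₁-budgeted w (incrementNeighbours G v s) u λ u≢w →
                   map₂ (increment-withinBudget v s u (λ u∈Nv sat →
                     contradiction (blocks u∈Nv sat) λ where (here u≡w) → u≢w u≡w)) (budgeted u)
    } where open Invariant I
  decide-invariant v (_ ∷ _ ∷ _) _ I = select₀-invariant v I

  process-invariant : ∀ {vs s} v → Invariant vs s → Invariant (v ∷ vs) (process G s v)
  process-invariant {s = s} v I =
    decide-invariant v _ (λ u∈Nv sat → ∈-elements⁺ (saturated⇒blocked s u∈Nv sat))
      -- `block` changes only `blocked`, which the invariant does not mention, so the same fields
      -- serve for the new state.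
      (record { Invariant I })

  -- Each step conses the node just processed, so the list accumulates in reverse; `ʳ++` unfolds in
  -- the same way and no transport is required.
  foldl-invariant : ∀ {us s} vs → Invariant us s →
                    Invariant (vs ʳ++ us) (foldl (process G) s vs)
  foldl-invariant []       I = I
  foldl-invariant (v ∷ vs) I = foldl-invariant vs (process-invariant v I)

  S₁-or-τ≤∣N∩S₀∣ : ∀ {vs s} → ThresholdAssignment G τ → Invariant vs s → (∀ v → v ∈ˡ vs) →
                   ∀ u → u ∈ S₁ s ⊎ τ u ≤ ∣ N G u ∩ S₀ s ∣
  S₁-or-τ≤∣N∩S₀∣ {s = s} τ≤d I all u = map₂ enough (budgeted u)
    where
    open Invariant I
    open ≤-Reasoning
    enough : WithinBudget s u → τ u ≤ ∣ N G u ∩ S₀ s ∣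
    enough (_ , le) = begin
      -- Truncated subtraction undoes itself here because `τ u ≤ d G u`. Bounding the skipped
      -- neighbours from above then bounds the remaining ones from below.
      τ u                           ≡⟨ m∸[m∸n]≡n (τ≤d u) ⟨
      d G u ∸ (d G u ∸ τ u)         ≤⟨ ∸-monoʳ-≤ (d G u) (≤-trans (counted u) le) ⟩
      d G u ∸ ∣ N G u ∩ skipped ∣   ≤⟨ m≤n+o⇒m∸n≤o (d G u) ∣ N G u ∩ skipped ∣ d≤ ⟩
      ∣ N G u ∩ S₀ s ∣              ∎
      where
      d≤ : d G u ≤ ∣ N G u ∩ skipped ∣ + ∣ N G u ∩ S₀ s ∣
      d≤ = begin
        d G u                                     ≤⟨ ∣p∣≤∣p∩q∣ (N G u) (λ v → covered (all v)) ⟩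
        ∣ N G u ∩ (S₀ s ∪ skipped) ∣              ≤⟨ ∣p∩[q∪r]∣≤∣p∩q∣+∣p∩r∣ (N G u) (S₀ s) skipped ⟩
        ∣ N G u ∩ S₀ s ∣ + ∣ N G u ∩ skipped ∣    ≡⟨ +-comm ∣ N G u ∩ S₀ s ∣ _ ⟩
        ∣ N G u ∩ skipped ∣ + ∣ N G u ∩ S₀ s ∣    ∎

  isTTS : ∀ A B → ThresholdAssignment G τ → (∀ u → u ∈ B ⊎ τ u ≤ ∣ N G u ∩ A ∣) →
          IsTTS G τ (A ∷ B ∷ ⊥ ∷ [])
  isTTS A B τ≤d reached = record
    { Q       = ⊥ ∷ Q₁ ∷ ⊤ ∷ []
    ; Q-start = refl
    ; Q-step  = λ where
        zero       v → mk⇔ (∈⟪⟫⁻ τ≤?) (∈⟪⟫⁺ τ≤?)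
        -- Both sides hold outright: every neighbour of `v` lies in `B ∪ Q₁`, so the count reaches
        -- `d G v`, hence `τ v`.
        (suc zero) v → mk⇔ (λ _ → ≤-trans (τ≤d v) (∣p∣≤∣p∩q∣ (N G v) B∪Q₁-full)) (λ _ → ∈⊤)
    ; S-end   = refl
    ; Q-end   = refl
    }
    where
    -- The union with `⊥` is `Q₀`, kept so that the predicate matches the first `Q-step` literally;
    -- `∪-identityʳ` removes it below.
    τ≤? : U.Decidable (λ v → τ v ≤ ∣ N G v ∩ (A ∪ ⊥) ∣)
    τ≤? v = τ v ≤? ∣ N G v ∩ (A ∪ ⊥) ∣

    Q₁ : Subset n
    Q₁ = ⟪ τ≤? ⟫

    B∪Q₁-full : ∀ u → u ∈ B ∪ Q₁
    B∪Q₁-full u = x∈p∪q⁺ (map₂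
      (∈⟪⟫⁺ τ≤? ∘ subst (λ A → τ u ≤ ∣ N G u ∩ A ∣) (sym (∪-identityʳ A))) (reached u))

theorem7 : ∀ {n : ℕ} (G : SimpleGraph n) (τ : Fin n → ℕ) → ThresholdAssignment G τ →
    (vs : List (Fin n)) → IsDegreeOrdering G vs →
    IsTTS G τ (State.S₀ (greedy G τ vs) ∷ State.S₁ (greedy G τ vs) ∷ ⊥ ∷ [])
theorem7 G τ τ≤d vs (vs↭all , _) =
  isTTS G τ _ _ τ≤d
    (S₁-or-τ≤∣N∩S₀∣ G τ τ≤d (foldl-invariant G τ vs (initial-invariant G τ))
      -- `vs ʳ++ []` computes to the reversal of `vs`, and `vs` lists every node because it permutes
      -- `allFin n`.
      (λ v → reverse⁺ (∈-resp-↭ (↭-sym vs↭all) (∈-allFin v))))
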